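{- For every BPPS instance (with $k$ a valid upper bound on the number of bins and $\mathcal{B}=\{1,\dots,k\}$), an optimal solution to the linear program $\mathrm{LP}_{\mathrm N}$ is $$x_{ib}=\frac1k\ \ (i\in\mathcal I,\ b\in\mathcal B),\qquad y_{cb}=\frac1k\ \ (c\in\mathcal C,\ b\in\mathcal B),\qquad z_b=\frac{\sum_{i\in\mathcal I}w_i+\sum_{c\in\mathcal C}s_c}{k\,d}\ \ (b\in\mathcal B),$$ and its optimal objective function value is $$\zeta(\mathrm{LP}_{\mathrm N})=\frac{r}{d}\Big(\sum_{i\in\mathcal I}w_i+\sum_{c\in\mathcal C}s_c\Big)+\sum_{c\in\mathcal C}f_c.$$
   Context: Bin Packing Problem with Setups (BPPS). An instance consists of: a bin capacity $d\in\mathbb Z_{\ge1}$; items $\mathcal I=\{1,\dots,n\}$ with weights $w_i\in\mathbb Z_{\ge1}$; classes $\mathcal C=\{1,\dots,m\}$ and a partition $\{\mathcal I_1,\dots,\mathcal I_m\}$ of $\mathcal I$ into (nonempty) classes; for each class $c$ a setup weight $s_c\in\mathbb Z_{\ge0}$ and a setup cost $f_c\in\mathbb Z_{\ge0}$; a bin cost $r\in\mathbb Z_{\ge1}$. It is assumed that $w_i+s_c\le d$ for all $c\in\mathcal C$, $i\in\mathcal I_c$, and that the items cannot all be packed in a single bin, i.e. $\sum_{i\in\mathcal I}w_i+\sum_{c\in\mathcal C}s_c>d$. For $S\subseteq\mathcal I$ let $\mathcal C(S)=\{c\in\mathcal C: S\cap\mathcal I_c\neq\emptyset\}$. A packing pattern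 is a subset $S\subseteq\mathcal I$ with $\sum_{i\in S}w_i+\sum_{c\in\mathcal C(S)}s_c\le d$. A feasible solution is a partition $\mathcal S$ of $\mathcal I$ into (nonempty) packing patterns (used bins); its cost is $r|\mathcal S|+\sum_{S\in\mathcal S}\sum_{c\in\mathcal C(S)}f_c$. The problem is to find a feasible solution of minimum cost. Let $k\in\mathbb Z_{\ge1}$ be an upper bound on the number of bins used in any optimal BPPS solution and $\mathcal B=\{1,\dots,k\}$. The linear program $\mathrm{LP}_{\mathrm N}$ is: minimize $\sum_{b\in\mathcal B}\big(r z_b+\sum_{c\in\mathcal C}f_c y_{cb}\big)$ subject to - $\sum_{b\in\mathcal B}x_{ib}=1$ for all $i\in\mathcal I$; - $\sum_{i\in\mathcal I}w_ix_{ib}+\sum_{c\in\mathcal C}s_cy_{cb}\le d\,z_b$ for all $b\in\mathcal B$; - $x_{ib}\le y_{cb}$ for all $c\in\mathcal C$, $i\in\mathcal I_c$, $b\in\mathcal B$; - $0\le x_{ib}\le1$, $0\le y_{cb}\le1$, $0\le z_b\le1$ for all $i\in\mathcal I,c\in\mathcal C,b\in\mathcal B$. (It is the LP relaxation of the integer program with all variables binary.) $\zeta(\mathrm{LP}_{\mathrm N})$ denotes its optimal objective function value. -}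

module Defs where

open import Algebra.Bundles using (CommutativeRing)
import Algebra.Definitions.RawMonoid as RawMonoidDefinitions
import Algebra.Properties.Semiring.Sum as SemiringSum
open import Data.Bool.Base using (if_then_else_)
open import Data.Fin.Base using (Fin)
open import Data.Fin.Subset using (Subset; _∈_; _∩_; Nonempty)
open import Data.Fin.Subset.Properties using (_∈?_; nonempty?)
open import Data.Nat.Base as ℕ using (ℕ)
open import Data.Nat.Properties using (+-*-semiring)
open import Data.Product using (∃; ∃!; _×_)
open import Data.Rational.Base as ℚ using (ℚ; 0ℚ; 1/_; ≢-nonZero)
import Data.Rational.Properties as ℚ
open import Data.Vec.Base using (tabulate)
open import Data.Vec.Functional using (Vector)
open import Level using (Level; 0ℓ; _⊔_) renaming (suc to lsuc)
open import Relation.Binary.Core using (Rel)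
open import Relation.Binary.PropositionalEquality using (_≡_)
open import Relation.Binary.Structures using (IsTotalOrder)
open import Relation.Nullary using (¬_; does; yes; no; contradiction)

module ℕ-Sum = SemiringSum +-*-semiring

-- The linear program is stated over an arbitrary ordered field, so that both
-- ℚ and (any model of) ℝ are covered.  As usual for a total _⁻¹, the value
-- 0# ⁻¹ is unconstrained.

record OrderedField (c ℓ₁ ℓ₂ : Level) : Set (lsuc (c ⊔ ℓ₁ ⊔ ℓ₂)) where
  infix  4 _≤_
  infix  8 _⁻¹
  infixl 7 _/_

  field
    commutativeRing : CommutativeRing c ℓ₁

  open CommutativeRing commutativeRing public

  field
    _≤_          : Rel Carrier ℓ₂
    _⁻¹          : Carrier → Carrier
    0≉1          : ¬ 0# ≈ 1#
    *-inverseʳ   : ∀ x → ¬ x ≈ 0# → x * x ⁻¹ ≈ 1#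
    isTotalOrder : IsTotalOrder _≈_ _≤_
    +-monoˡ-≤    : ∀ z {x y} → x ≤ y → x + z ≤ y + z
    *-nonNeg     : ∀ {x y} → 0# ≤ x → 0# ≤ y → 0# ≤ x * y

  _/_ : Carrier → Carrier → Carrier
  x / y = x * y ⁻¹

  -- The canonical map ℕ → K, n ↦ 1# + ⋯ + 1#.
  ι : ℕ → Carrier
  ι n = RawMonoidDefinitions._×_ +-rawMonoid n 1#

ℚ-orderedField : OrderedField 0ℓ 0ℓ 0ℓ
ℚ-orderedField = record
  { commutativeRing = ℚ.+-*-commutativeRing
  ; _≤_             = ℚ._≤_
  ; _⁻¹             = inv
  ; 0≉1             = λ ()
  ; *-inverseʳ      = inv-inverseʳ
  ; isTotalOrder    = ℚ.≤-isTotalOrder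
  ; +-monoˡ-≤       = λ z → ℚ.+-monoˡ-≤ z
  ; *-nonNeg        = nonNeg
  }
  where
  inv : ℚ → ℚ
  inv p with p ℚ.≟ 0ℚ
  ... | yes _  = 0ℚ
  ... | no p≢0 = let instance _ = ≢-nonZero p≢0 in 1/ p

  inv-inverseʳ : ∀ p → ¬ p ≡ 0ℚ → p ℚ.* inv p ≡ ℚ.1ℚ
  inv-inverseʳ p p≢0 with p ℚ.≟ 0ℚ
  ... | yes p≡0 = contradiction p≡0 p≢0
  ... | no p≢0′ = let instance _ = ≢-nonZero p≢0′ in ℚ.*-inverseʳ p

  nonNeg : ∀ {p q} → 0ℚ ℚ.≤ p → 0ℚ ℚ.≤ q → 0ℚ ℚ.≤ p ℚ.* q
  nonNeg {p} {q} 0≤p 0≤q =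
    let instance _ = ℚ.nonNegative 0≤p
                 _ = ℚ.nonNegative 0≤q
    in ℚ.nonNegative⁻¹ (p ℚ.* q) {{ℚ.nonNeg*nonNeg⇒nonNeg p q}}

-- A partition of Fin n, presented as a family of blocks; the enumeration of
-- the blocks is immaterial to everything below.
record IsPartition {n p : ℕ} (P : Vector (Subset n) p) : Set where
  field
    nonempty : ∀ j → Nonempty (P j)
    exactly1 : ∀ i → ∃! _≡_ (λ j → i ∈ P j)

∑∈ : ∀ {n} → Subset n → (Fin n → ℕ) → ℕ
∑∈ S g = ℕ-Sum.sum (λ i → if does (i ∈? S) then g i else 0)

record Instance : Set where
  open ℕ-Sum using (sum-syntax)

  field
    d : ℕ                          -- bin capacity
    n : ℕ                          -- number of items
    m : ℕ                          -- number of classes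
    w : Fin n → ℕ                  -- item weights
    𝓘 : Vector (Subset n) m        -- classes
    s : Fin m → ℕ                  -- setup weights
    f : Fin m → ℕ                  -- setup costs
    r : ℕ                          -- bin cost

    d≥1         : 1 ℕ.≤ d
    w≥1         : ∀ i → 1 ℕ.≤ w i
    r≥1         : 1 ℕ.≤ r
    isPartition : IsPartition 𝓘
    fits        : ∀ c i → i ∈ 𝓘 c → w i ℕ.+ s c ℕ.≤ d
    notOneBin   : d ℕ.< ∑[ i < n ] w i ℕ.+ ∑[ c < m ] s c

module Packing (I : Instance) where
  open Instance I
  open ℕ-Sum using (sum-syntax)

  𝓒 : Subset n → Subset m
  𝓒 S = tabulate (λ c → does (nonempty? (S ∩ 𝓘 c)))

  IsPattern : Subset n → Set
  IsPattern S = ∑∈ S w ℕ.+ ∑∈ (𝓒 S) s ℕ.≤ d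

  record FeasibleSolution : Set where
    field
      #bins       : ℕ
      bins        : Vector (Subset n) #bins
      isPartition : IsPartition bins
      isPattern   : ∀ b → IsPattern (bins b)

  open FeasibleSolution public using (#bins; bins)

  cost : FeasibleSolution → ℕ
  cost 𝓢 = r ℕ.* #bins 𝓢 ℕ.+ ∑[ b < #bins 𝓢 ] ∑∈ (𝓒 (bins 𝓢 b)) f

  IsOptimalSolution : FeasibleSolution → Set
  IsOptimalSolution 𝓢 = ∀ 𝓣 → cost 𝓢 ℕ.≤ cost 𝓣

  IsBinBound : ℕ → Set
  IsBinBound k = ∀ 𝓢 → IsOptimalSolution 𝓢 → #bins 𝓢 ℕ.≤ k

module LPN {c ℓ₁ ℓ₂} (K : OrderedField c ℓ₁ ℓ₂) (I : Instance) (k : ℕ) where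
  open OrderedField K
  open Instance I
  open SemiringSum semiring public using (sum-syntax)

  record Point : Set c where
    constructor ⟨_,_,_⟩
    field
      x : Fin n → Fin k → Carrier
      y : Fin m → Fin k → Carrier
      z : Fin k → Carrier

  objective : Point → Carrier
  objective ⟨ x , y , z ⟩ =
    ∑[ b < k ] (ι r * z b + ∑[ c < m ] (ι (f c) * y c b))

  record IsFeasible (p : Point) : Set (c ⊔ ℓ₁ ⊔ ℓ₂) where
    open Point p
    field
      assign   : ∀ i → ∑[ b < k ] x i b ≈ 1#
      capacity : ∀ b → ∑[ i < n ] (ι (w i) * x i b) + ∑[ c < m ] (ι (s c) * y c b)
                         ≤ ι d * z b
      setup    : ∀ c i → i ∈ 𝓘 c → ∀ b → x i b ≤ y c b
      0≤x      : ∀ i b → 0# ≤ x i b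
      x≤1      : ∀ i b → x i b ≤ 1#
      0≤y      : ∀ c b → 0# ≤ y c b
      y≤1      : ∀ c b → y c b ≤ 1#
      0≤z      : ∀ b → 0# ≤ z b
      z≤1      : ∀ b → z b ≤ 1#

  IsOptimal : Point → Set (c ⊔ ℓ₁ ⊔ ℓ₂)
  IsOptimal p = IsFeasible p × (∀ q → IsFeasible q → objective p ≤ objective q)

  -- ζ(LP) ≈ v, as a relation since an optimum need not exist a priori.
  IsOptimalValue : Carrier → Set (c ⊔ ℓ₁ ⊔ ℓ₂)
  IsOptimalValue v = ∃ λ p → IsOptimal p × objective p ≈ v

{-# OPTIONS --safe #-}

-- Summing the capacity constraints over the bins and using ∑_b x_ib = 1, and
-- hence ∑_b y_cb ≥ 1, gives d ∑_b z_b ≥ W + S; together with ∑_b y_cb ≥ 1 this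
-- is the lower bound on the objective, and the uniform point attains it.  The
-- only constraint that is not immediate for the uniform point is z_b ≤ 1, that
-- is W + S ≤ k d.  It holds because an optimal packing uses at most k bins, each
-- of load at most d, and pays for every item and every setup at least once.

module Submission where

open import Defs
open import Data.Nat.Base as ℕ using (ℕ; z≤n; s≤s)
open import Data.Product using (_×_; _,_; ∃)

import Algebra.Properties.Ring as RingProperties
open import Data.Bool.Base using (true; if_then_else_)
open import Data.Fin.Base using (Fin; zero; suc)
open import Data.Fin.Properties using (suc-injective)
open import Data.Fin.Subset using (Subset; _∈_; _∩_; ⁅_⁆)
open import Data.Fin.Subset.Properties using (_∈?_; nonempty?; x∈⁅x⁆; x∈⁅y⁆⇒x≡y; x∈p∩q⁺; x∈p∩q⁻)
open import Data.Nat.Induction using (<-rec)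
import Data.Nat.Properties as ℕ
open import Data.Sum.Base using (inj₁; inj₂; [_,_]′)
open import Data.Vec.Functional using (Vector)
open import Data.Vec.Properties using (lookup∘tabulate; lookup⇒[]=; []=⇒lookup)
open import Function.Base using (_∘_; id)
open import Relation.Binary.Bundles using (Poset)
import Relation.Binary.Construct.NonStrictToStrict as NonStrictToStrict
import Relation.Binary.Reasoning.PartialOrder as PartialOrderReasoning
open import Relation.Binary.PropositionalEquality as ≡ using (_≡_; _≢_)
open import Relation.Binary.Structures using (IsTotalOrder)
open import Relation.Nullary using (¬_; Dec; does; yes; no; contradiction)
open import Relation.Nullary.Decidable using (decidable-stable; dec-true)
import Algebra.Properties.Semiring.Mult as SemiringMult
import Algebra.Properties.Semiring.Sum as SemiringSum
import Algebra.Solver.CommutativeMonoid as CommutativeMonoidSolver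

does-true⇒ : ∀ {a} {A : Set a} (a? : Dec A) → does a? ≡ true → A
does-true⇒ (yes a) _ = a

-- Finite sums of natural numbers over subsets and covers.

module _ where
  open ℕ-Sum
  open ℕ.≤-Reasoning

  sum-mono : ∀ {n} {g h : Vector ℕ n} → (∀ i → g i ℕ.≤ h i) → sum g ℕ.≤ sum h
  sum-mono {ℕ.zero}  g≤h = z≤n
  sum-mono {ℕ.suc n} g≤h = ℕ.+-mono-≤ (g≤h zero) (sum-mono (g≤h ∘ suc))

  term≤sum : ∀ {n} (g : Vector ℕ n) i → g i ℕ.≤ sum g
  term≤sum g zero    = ℕ.m≤m+n _ _
  term≤sum g (suc i) = ℕ.≤-trans (term≤sum (g ∘ suc) i) (ℕ.m≤n+m _ _)

  sum-single : ∀ {n} (g : Vector ℕ n) i → (∀ j → j ≢ i → g j ≡ 0) → sum g ≡ g i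
  sum-single {ℕ.suc n} g zero    g≡0 = ≡.trans
    (≡.cong (g zero ℕ.+_) (≡.trans (sum-cong-≗ (λ j → g≡0 (suc j) λ ())) (sum-replicate-zero n)))
    (ℕ.+-identityʳ _)
  sum-single {ℕ.suc n} g (suc i) g≡0 = ≡.cong₂ ℕ._+_ (g≡0 zero λ ())
    (sum-single (g ∘ suc) i λ j j≢i → g≡0 (suc j) (j≢i ∘ suc-injective))

  -- The masked summand vanishes away from `i`, so the sum collapses to its term at `i`, which is
  -- `g i` or `0`. The bound is an inequality because `S` may be empty.
  ∑∈-subsingleton : ∀ {n} {S : Subset n} {i} (g : Fin n → ℕ) →
                    (∀ {j} → j ∈ S → j ≡ i) → ∑∈ S g ℕ.≤ g i
  ∑∈-subsingleton {S = S} {i} g S⊆i =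
    ≡.subst (ℕ._≤ g i) (≡.sym (sum-single h i h≡0)) h≤g
    where
    h = λ j → if does (j ∈? S) then g j else 0
    h≡0 : ∀ j → j ≢ i → h j ≡ 0
    h≡0 j j≢i with j ∈? S
    ... | yes j∈S = contradiction (S⊆i j∈S) j≢i
    ... | no _    = ≡.refl
    h≤g : h i ℕ.≤ g i
    h≤g with i ∈? S
    ... | yes _ = ℕ.≤-refl
    ... | no _  = z≤n

  -- Double counting: each `g i` occurs in the masked sum of some block, and the two summations are
  -- exchanged. Stated for covers because a class may be set up in several bins.
  sum≤∑∈-cover : ∀ {n p} (P : Vector (Subset n) p) (g : Fin n → ℕ) →
                 (∀ i → ∃ λ j → i ∈ P j) → sum g ℕ.≤ ∑[ j < p ] ∑∈ (P j) g
  sum≤∑∈-cover {n} {p} P g covers = begin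
    sum g                        ≤⟨ sum-mono (λ i → let j , i∈Pj = covers i in begin
      g i                          ≡⟨ ≡.cong (if_then g i else 0) (dec-true (i ∈? P j) i∈Pj) ⟨
      h i j                        ≤⟨ term≤sum (h i) j ⟩
      ∑[ j < p ] h i j             ∎) ⟩
    ∑[ i < n ] ∑[ j < p ] h i j  ≡⟨ ∑-comm h ⟩
    ∑[ j < p ] ∑∈ (P j) g        ∎
    where h = λ i j → if does (i ∈? P j) then g i else 0

-- Packings: existence of solutions and the bound on the total load.

module PackingProperties (I : Instance) where
  open Instance I
  open Packing I
  open ℕ-Sum
  module 𝓘 = IsPartition isPartition

  ∈𝓒⁺ : ∀ {S c i} → i ∈ S → i ∈ 𝓘 c → c ∈ 𝓒 S
  ∈𝓒⁺ {S} {c} {i} i∈S i∈𝓘c = lookup⇒[]= c _ (≡.trans (lookup∘tabulate _ c)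
    (dec-true (nonempty? (S ∩ 𝓘 c)) (i , x∈p∩q⁺ (i∈S , i∈𝓘c))))

  ∈𝓒⁻ : ∀ {S c} → c ∈ 𝓒 S → ∃ λ i → i ∈ S × i ∈ 𝓘 c
  ∈𝓒⁻ {S} {c} c∈𝓒S =
    let i , i∈S∩𝓘c = does-true⇒ (nonempty? (S ∩ 𝓘 c))
                       (≡.trans (≡.sym (lookup∘tabulate _ c)) ([]=⇒lookup c∈𝓒S))
    in i , x∈p∩q⁻ S (𝓘 c) i∈S∩𝓘c

  -- One bin per item, which `fits` makes a pattern. It gives the descent in `¬¬optimal` a starting
  -- point.
  singletons : FeasibleSolution
  singletons = record
    { #bins       = n
    ; bins        = ⁅_⁆
    ; isPartition = record
      { nonempty = λ i → i , x∈⁅x⁆ i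
      ; exactly1 = λ i → i , x∈⁅x⁆ i , ≡.sym ∘ x∈⁅y⁆⇒x≡y _ ∘ flip
      }
    ; isPattern   = pattern-⁅⁆
    }
    where
    flip : ∀ {i j} → i ∈ ⁅ j ⁆ → j ∈ ⁅ i ⁆
    flip {i} {j} i∈⁅j⁆ = ≡.subst (λ l → l ∈ ⁅ i ⁆) (x∈⁅y⁆⇒x≡y j i∈⁅j⁆) (x∈⁅x⁆ i)
    pattern-⁅⁆ : ∀ i → IsPattern ⁅ i ⁆
    pattern-⁅⁆ i with 𝓘.exactly1 i
    ... | c , i∈𝓘c , unique = ℕ.≤-trans
      (ℕ.+-mono-≤ (∑∈-subsingleton w (x∈⁅y⁆⇒x≡y i)) (∑∈-subsingleton s only-c))
      (fits c i i∈𝓘c)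
      where
      -- A class that meets `⁅ i ⁆` contains `i`, so it is the unique class of `i`.
      only-c : ∀ {c′} → c′ ∈ 𝓒 ⁅ i ⁆ → c′ ≡ c
      only-c {c′} c′∈ = let j , j∈⁅i⁆ , j∈𝓘c′ = ∈𝓒⁻ {⁅ i ⁆} c′∈ in
        ≡.sym (unique (≡.subst (_∈ 𝓘 c′) (x∈⁅y⁆⇒x≡y i j∈⁅i⁆) j∈𝓘c′))

  total≤#bins*d : ∀ 𝓢 → sum w ℕ.+ sum s ℕ.≤ #bins 𝓢 ℕ.* d
  total≤#bins*d 𝓢 = begin
    sum w ℕ.+ sum s
      ≤⟨ ℕ.+-mono-≤ (sum≤∑∈-cover B w item-covered) (sum≤∑∈-cover (𝓒 ∘ B) s class-covered) ⟩
    (∑[ b < p ] ∑∈ (B b) w) ℕ.+ (∑[ b < p ] ∑∈ (𝓒 (B b)) s)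
      ≡⟨ ∑-distrib-+ (λ b → ∑∈ (B b) w) (λ b → ∑∈ (𝓒 (B b)) s) ⟨
    ∑[ b < p ] (∑∈ (B b) w ℕ.+ ∑∈ (𝓒 (B b)) s)
      ≤⟨ sum-mono (FeasibleSolution.isPattern 𝓢) ⟩
    ∑[ b < p ] d
      ≡⟨ sum-const p ⟩
    p ℕ.* d ∎
    where
    open ℕ.≤-Reasoning
    p = #bins 𝓢
    B = bins 𝓢
    sum-const : ∀ p → ∑[ b < p ] d ≡ p ℕ.* d
    sum-const ℕ.zero    = ≡.refl
    sum-const (ℕ.suc p) = ≡.cong (d ℕ.+_) (sum-const p)
    item-covered : ∀ i → ∃ λ b → i ∈ B b
    item-covered i = let b , i∈b , _ = IsPartition.exactly1 (FeasibleSolution.isPartition 𝓢) i in b , i∈b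
    -- A class has at least one item, and the bin of that item pays the setup.
    class-covered : ∀ c → ∃ λ b → c ∈ 𝓒 (B b)
    class-covered c = let i , i∈𝓘c = 𝓘.nonempty c ; b , i∈b = item-covered i in b , ∈𝓒⁺ i∈b i∈𝓘c

  -- Strong induction on the cost: if no solution is cheaper than `𝓢`, then `𝓢` is optimal, contrary
  -- to `none`. Hence no cost is attained at all, yet `singletons` attains one.
  ¬¬optimal : ¬ (∀ 𝓢 → ¬ IsOptimalSolution 𝓢)
  ¬¬optimal none = <-rec (λ v → ∀ 𝓢 → ¬ cost 𝓢 ≡ v) descend (cost singletons) singletons ≡.refl
    where
    descend : ∀ v → (∀ {u} → u ℕ.< v → ∀ 𝓢 → ¬ cost 𝓢 ≡ u) → ∀ 𝓢 → ¬ cost 𝓢 ≡ v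
    descend _ rec 𝓢 ≡.refl = none 𝓢 λ 𝓣 → ℕ.≮⇒≥ λ 𝓣<𝓢 → rec 𝓣<𝓢 𝓣 ≡.refl

  -- An optimal solution is only known not not to exist, which suffices because
  -- the inequality is decidable.
  total≤k*d : ∀ {k} → IsBinBound k → sum w ℕ.+ sum s ℕ.≤ k ℕ.* d
  total≤k*d bound = decidable-stable (_ ℕ.≤? _) λ total≰k*d → ¬¬optimal λ 𝓢 opt →
    total≰k*d (ℕ.≤-trans (total≤#bins*d 𝓢) (ℕ.*-monoˡ-≤ d (bound 𝓢 opt)))

-- Order and division in an ordered field.

module OrderedFieldProperties {a ℓ₁ ℓ₂} (K : OrderedField a ℓ₁ ℓ₂) where
  open OrderedField K hiding (zero)
  open IsTotalOrder isTotalOrder public using (total; antisym)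
    renaming (refl to ≤-refl; reflexive to ≤-reflexive; trans to ≤-trans)
  open NonStrictToStrict _≈_ _≤_ public using (_<_)
  open SemiringSum semiring
  open SemiringMult semiring using (×-homo-+; ×1-homo-*)
  open RingProperties ring using (-1*x≈-x; -‿involutive)

  poset : Poset a ℓ₁ ℓ₂
  poset = record { isPartialOrder = IsTotalOrder.isPartialOrder isTotalOrder }

  open PartialOrderReasoning poset

  +-mono-≤ : ∀ {x y u v} → x ≤ y → u ≤ v → x + u ≤ y + v
  +-mono-≤ {x} {y} {u} {v} x≤y u≤v = begin
    x + u ≤⟨ +-monoˡ-≤ u x≤y ⟩
    y + u ≈⟨ +-comm y u ⟩
    u + y ≤⟨ +-monoˡ-≤ y u≤v ⟩
    v + y ≈⟨ +-comm v y ⟩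
    y + v ∎

  x≤y⇒0≤y-x : ∀ {x y} → x ≤ y → 0# ≤ y - x
  x≤y⇒0≤y-x {x} {y} x≤y = begin
    0#    ≈⟨ -‿inverseʳ x ⟨
    x - x ≤⟨ +-monoˡ-≤ (- x) x≤y ⟩
    y - x ∎

  x-y+y≈x : ∀ x y → x - y + y ≈ x
  x-y+y≈x x y = trans (+-assoc x (- y) y) (trans (+-congˡ (-‿inverseˡ y)) (+-identityʳ x))

  -- The product `z * (y - x)` is nonnegative; adding `z * x` to it gives `z * y`.
  *-monoˡ-≤ : ∀ {z x y} → 0# ≤ z → x ≤ y → z * x ≤ z * y
  *-monoˡ-≤ {z} {x} {y} 0≤z x≤y = begin
    z * x               ≈⟨ +-identityˡ (z * x) ⟨
    0# + z * x          ≤⟨ +-monoˡ-≤ (z * x) (*-nonNeg 0≤z (x≤y⇒0≤y-x x≤y)) ⟩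
    z * (y - x) + z * x ≈⟨ distribˡ z (y - x) x ⟨
    z * (y - x + x)     ≈⟨ *-congˡ (x-y+y≈x y x) ⟩
    z * y               ∎

  *-monoʳ-≤ : ∀ {z x y} → 0# ≤ z → x ≤ y → x * z ≤ y * z
  *-monoʳ-≤ {z} {x} {y} 0≤z x≤y = begin
    x * z ≈⟨ *-comm x z ⟩
    z * x ≤⟨ *-monoˡ-≤ 0≤z x≤y ⟩
    z * y ≈⟨ *-comm z y ⟩
    y * z ∎

  -- If instead `1# ≤ 0#`, then `- 1#` is nonnegative, and so is its square `1#`.
  0≤1 : 0# ≤ 1#
  0≤1 = [ id , via-square ]′ (total 0# 1#)
    where
    via-square : 1# ≤ 0# → 0# ≤ 1#
    via-square 1≤0 = begin
      0#          ≤⟨ *-nonNeg 0≤-1 0≤-1 ⟩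
      - 1# * - 1# ≈⟨ -1*x≈-x (- 1#) ⟩
      - - 1#      ≈⟨ -‿involutive 1# ⟩
      1#          ∎
      where
      0≤-1 : 0# ≤ - 1#
      0≤-1 = ≤-trans (x≤y⇒0≤y-x 1≤0) (≤-reflexive (+-identityˡ (- 1#)))

  0<⇒≉0 : ∀ {x} → 0# < x → ¬ x ≈ 0#
  0<⇒≉0 (_ , 0≉x) = 0≉x ∘ sym

  -- A nonpositive inverse would make `1# ≈ x * x ⁻¹` nonpositive, forcing `0# ≈ 1#`.
  0≤⁻¹ : ∀ {x} → 0# < x → 0# ≤ x ⁻¹
  0≤⁻¹ {x} 0<x@(0≤x , _) with total 0# (x ⁻¹)
  ... | inj₁ 0≤x⁻¹ = 0≤x⁻¹
  ... | inj₂ x⁻¹≤0 = contradiction (antisym 0≤1 (begin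
    1#       ≈⟨ *-inverseʳ x (0<⇒≉0 0<x) ⟨
    x * x ⁻¹ ≤⟨ *-monoˡ-≤ 0≤x x⁻¹≤0 ⟩
    x * 0#   ≈⟨ zeroʳ x ⟩
    0#       ∎)) 0≉1

  x≤y⇒x/y≤1 : ∀ {x y} → 0# < y → x ≤ y → x / y ≤ 1#
  x≤y⇒x/y≤1 {x} {y} 0<y x≤y = begin
    x / y ≤⟨ *-monoʳ-≤ (0≤⁻¹ 0<y) x≤y ⟩
    y / y ≈⟨ *-inverseʳ y (0<⇒≉0 0<y) ⟩
    1#    ∎

  yx/y≈x : ∀ {x y} → ¬ y ≈ 0# → y * x / y ≈ x
  yx/y≈x {x} {y} y≉0 = begin-equality
    y * x * y ⁻¹   ≈⟨ *-congʳ (*-comm y x) ⟩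
    x * y * y ⁻¹   ≈⟨ *-assoc x y (y ⁻¹) ⟩
    x * (y * y ⁻¹) ≈⟨ *-congˡ (*-inverseʳ y y≉0) ⟩
    x * 1#         ≈⟨ *-identityʳ x ⟩
    x              ∎

  x/z≤y : ∀ {x y z} → 0# < z → x ≤ z * y → x / z ≤ y
  x/z≤y {x} {y} {z} 0<z x≤zy = begin
    x / z     ≤⟨ *-monoʳ-≤ (0≤⁻¹ 0<z) x≤zy ⟩
    z * y / z ≈⟨ yx/y≈x (0<⇒≉0 0<z) ⟩
    y         ∎

  -- The hypothesis z ≈ u * v stands in for a congruence law of _⁻¹, which
  -- OrderedField does not assume.
  u*[x/z]≈x/v : ∀ {x u v z} → ¬ v ≈ 0# → ¬ z ≈ 0# → z ≈ u * v → u * (x / z) ≈ x / v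
  u*[x/z]≈x/v {x} {u} {v} {z} v≉0 z≉0 z≈uv = begin-equality
    u * (x / z)             ≈⟨ yx/y≈x v≉0 ⟨
    v * (u * (x / z)) / v   ≈⟨ *-congʳ (solve 4 (λ v u x z⁻¹ → v ⊕ (u ⊕ (x ⊕ z⁻¹)) ⊜ x ⊕ ((u ⊕ v) ⊕ z⁻¹)) refl v u x (z ⁻¹)) ⟩
    x * (u * v * z ⁻¹) / v  ≈⟨ *-congʳ (*-congˡ (*-congʳ z≈uv)) ⟨
    x * (z * z ⁻¹) / v      ≈⟨ *-congʳ (*-congˡ (*-inverseʳ z z≉0)) ⟩
    x * 1# / v              ≈⟨ *-congʳ (*-identityʳ x) ⟩
    x / v                   ∎
    where open CommutativeMonoidSolver *-commutativeMonoid using (solve; _⊕_; _⊜_)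

  -- The embedding of the natural numbers, and finite sums in the field.

  ι-homo-+ : ∀ m n → ι (m ℕ.+ n) ≈ ι m + ι n
  ι-homo-+ = ×-homo-+ 1#

  ι-homo-* : ∀ m n → ι (m ℕ.* n) ≈ ι m * ι n
  ι-homo-* = ×1-homo-*

  ι-homo-sum : ∀ {n} (g : Vector ℕ n) → ι (ℕ-Sum.sum g) ≈ ∑[ i < n ] ι (g i)
  ι-homo-sum {ℕ.zero}  g = refl
  ι-homo-sum {ℕ.suc n} g = trans (ι-homo-+ (g zero) _) (+-congˡ (ι-homo-sum (g ∘ suc)))

  0≤ι : ∀ n → 0# ≤ ι n
  0≤ι ℕ.zero    = ≤-refl
  0≤ι (ℕ.suc n) = ≤-trans (≤-reflexive (sym (+-identityˡ 0#))) (+-mono-≤ 0≤1 (0≤ι n))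

  ι-mono : ∀ {m n} → m ℕ.≤ n → ι m ≤ ι n
  ι-mono {n = n} z≤n = 0≤ι n
  ι-mono (s≤s m≤n)   = +-mono-≤ ≤-refl (ι-mono m≤n)

  1≤ι : ∀ {n} → 1 ℕ.≤ n → 1# ≤ ι n
  -- `ι 1` unfolds to `1# + 0#`.
  1≤ι 1≤n = ≤-trans (≤-reflexive (sym (+-identityʳ 1#))) (ι-mono 1≤n)

  -- An ordered field has characteristic zero: `1# ≤ ι n` and `ι n ≈ 0#` together would collapse
  -- `1#` to `0#`.
  0<ι : ∀ {n} → 1 ℕ.≤ n → 0# < ι n
  0<ι {n} 1≤n = 0≤ι n , λ 0≈ιn → 0≉1 (antisym 0≤1 (≤-trans (1≤ι 1≤n) (≤-reflexive (sym 0≈ιn))))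

  ∑-mono-≤ : ∀ {n} {g h : Vector Carrier n} → (∀ i → g i ≤ h i) → sum g ≤ sum h
  ∑-mono-≤ {ℕ.zero}  g≤h = ≤-refl
  ∑-mono-≤ {ℕ.suc n} g≤h = +-mono-≤ (g≤h zero) (∑-mono-≤ (g≤h ∘ suc))

  ∑-const : ∀ n x → ∑[ i < n ] x ≈ ι n * x
  ∑-const n x = begin-equality
    ∑[ i < n ] x              ≈⟨ sum-cong-≋ {n} (λ _ → sym (*-identityˡ x)) ⟩
    ∑[ i < n ] (1# * x)       ≈⟨ *-distribʳ-sum {n} x (λ _ → 1#) ⟨
    (∑[ i < n ] 1#) * x       ≈⟨ *-congʳ (sum-replicate n) ⟩
    ι n * x                   ∎

  -- Pulls the weights out of the sum over bins, so that facts about the bin totals of `x` and `y`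
  -- can be applied.
  ∑-weighted-comm : ∀ {m n} (u : Vector Carrier m) (t : Fin m → Vector Carrier n) →
                    ∑[ j < n ] ∑[ i < m ] (u i * t i j) ≈ ∑[ i < m ] (u i * ∑[ j < n ] t i j)
  ∑-weighted-comm {m} {n} u t = begin-equality
    ∑[ j < n ] ∑[ i < m ] (u i * t i j)   ≈⟨ ∑-comm (λ j i → u i * t i j) ⟩
    ∑[ i < m ] ∑[ j < n ] (u i * t i j)   ≈⟨ sum-cong-≋ {m} (λ i → *-distribˡ-sum (u i) (t i)) ⟨
    ∑[ i < m ] (u i * ∑[ j < n ] t i j)   ∎

-- The linear program: the claimed value and the uniform point.

module LPNProperties {a ℓ₁ ℓ₂} (K : OrderedField a ℓ₁ ℓ₂) (I : Instance) {k : ℕ} (1≤k : 1 ℕ.≤ k) where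
  open OrderedField K
  open OrderedFieldProperties K
  open Instance I
  open LPN K I k hiding (sum-syntax)
  open SemiringSum semiring
  open PartialOrderReasoning poset

  W+S F : Carrier
  W+S = ∑[ i < n ] ι (w i) + ∑[ c < m ] ι (s c)
  F = ∑[ c < m ] ι (f c)

  value : Carrier
  value = (ι r / ι d) * W+S + F

  uniform : Point
  uniform = ⟨ (λ i b → 1# / ι k) , (λ c b → 1# / ι k) , (λ b → W+S / (ι k * ι d)) ⟩

  ιk≉0 : ¬ ι k ≈ 0#
  ιk≉0 = 0<⇒≉0 (0<ι 1≤k)

  ιd≉0 : ¬ ι d ≈ 0#
  ιd≉0 = 0<⇒≉0 (0<ι d≥1)

  -- Positivity is inherited from `ι (k ℕ.* d)` along `ι-homo-*`.
  0<ιkιd : 0# < ι k * ι d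
  0<ιkιd = let 0≤ιkd , 0≉ιkd = 0<ι (ℕ.*-mono-≤ 1≤k d≥1) in
    ≤-trans 0≤ιkd (≤-reflexive (ι-homo-* k d)) ,
    λ 0≈ιkιd → 0≉ιkd (trans 0≈ιkιd (sym (ι-homo-* k d)))

  W+Sℕ : ℕ
  W+Sℕ = ℕ-Sum.sum w ℕ.+ ℕ-Sum.sum s

  ιW+Sℕ≈W+S : ι W+Sℕ ≈ W+S
  ιW+Sℕ≈W+S = trans (ι-homo-+ (ℕ-Sum.sum w) (ℕ-Sum.sum s)) (+-cong (ι-homo-sum w) (ι-homo-sum s))

  -- Regrouped to match `objective-split` term by term: `W+S / ι d` is compared with the sum of the
  -- `z b`.
  value-split : value ≈ ι r * (W+S / ι d) + F
  value-split = +-congʳ (trans (*-assoc (ι r) _ _) (*-congˡ (*-comm _ _)))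

  -- The objective depends on a point only through the bin totals of `z` and of each `y c`.
  objective-split : ∀ p → let open Point p in
    objective p ≈ ι r * (∑[ b < k ] z b) + ∑[ c < m ] (ι (f c) * ∑[ b < k ] y c b)
  objective-split ⟨ x , y , z ⟩ = trans
    (∑-distrib-+ {k} (λ b → ι r * z b) (λ b → ∑[ c < m ] (ι (f c) * y c b)))
    (+-cong (sym (*-distribˡ-sum (ι r) z)) (∑-weighted-comm (ι ∘ f) y))

  ∑-1/k : ∑[ b < k ] (1# / ι k) ≈ 1#
  ∑-1/k = begin-equality
    ∑[ b < k ] (1# / ι k) ≈⟨ ∑-const k _ ⟩
    ι k * (1# / ι k)      ≈⟨ *-congˡ (*-identityˡ _) ⟩
    ι k * (ι k) ⁻¹        ≈⟨ *-inverseʳ (ι k) ιk≉0 ⟩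
    1#                    ∎

  objective-uniform : objective uniform ≈ value
  objective-uniform = begin-equality
    objective uniform
      ≈⟨ objective-split uniform ⟩
    ι r * (∑[ b < k ] (W+S / (ι k * ι d))) + ∑[ c < m ] (ι (f c) * ∑[ b < k ] (1# / ι k))
      -- Summing `k` equal values of `z` cancels the factor `ι k` in the denominator.
      ≈⟨ +-cong (*-congˡ (trans (∑-const k _) (u*[x/z]≈x/v ιd≉0 (0<⇒≉0 0<ιkιd) refl)))
                (sum-cong-≋ {m} λ c → trans (*-congˡ ∑-1/k) (*-identityʳ _)) ⟩
    ι r * (W+S / ι d) + F
      ≈⟨ value-split ⟨
    value ∎

  -- The lower bound at an arbitrary feasible point.

  module _ {q : Point} (feasible : IsFeasible q) where
    open Point q
    open IsFeasible feasible

    -- Any item of the nonempty class `c` is fully assigned over the bins, and its setup constraints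
    -- sum to the bound.
    1≤∑y : ∀ c → 1# ≤ ∑[ b < k ] y c b
    1≤∑y c = let i , i∈𝓘c = IsPartition.nonempty isPartition c in begin
      1#               ≈⟨ assign i ⟨
      ∑[ b < k ] x i b ≤⟨ ∑-mono-≤ (setup c i i∈𝓘c) ⟩
      ∑[ b < k ] y c b ∎

    -- Weights from the naturals are nonnegative, so `1≤∑y` may be scaled. Used with `s` for the
    -- load and with `f` for the cost.
    ∑ι≤∑ι*∑y : ∀ (g : Fin m → ℕ) → ∑[ c < m ] ι (g c) ≤ ∑[ c < m ] (ι (g c) * ∑[ b < k ] y c b)
    ∑ι≤∑ι*∑y g = ∑-mono-≤ λ c →
      ≤-trans (≤-reflexive (sym (*-identityʳ _))) (*-monoˡ-≤ (0≤ι (g c)) (1≤∑y c))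

    W+S≤d*∑z : W+S ≤ ι d * (∑[ b < k ] z b)
    W+S≤d*∑z = begin
      W+S
        ≤⟨ +-mono-≤ (≤-reflexive (sum-cong-≋ {n} λ i → sym (trans (*-congˡ (assign i)) (*-identityʳ _))))
                    (∑ι≤∑ι*∑y s) ⟩
      ∑[ i < n ] (ι (w i) * ∑[ b < k ] x i b) + ∑[ c < m ] (ι (s c) * ∑[ b < k ] y c b)
        ≈⟨ +-cong (∑-weighted-comm (ι ∘ w) x) (∑-weighted-comm (ι ∘ s) y) ⟨
      ∑[ b < k ] ∑[ i < n ] (ι (w i) * x i b) + ∑[ b < k ] ∑[ c < m ] (ι (s c) * y c b)
        ≈⟨ ∑-distrib-+ {k} (λ b → ∑[ i < n ] (ι (w i) * x i b)) (λ b → ∑[ c < m ] (ι (s c) * y c b)) ⟨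
      ∑[ b < k ] (∑[ i < n ] (ι (w i) * x i b) + ∑[ c < m ] (ι (s c) * y c b))
        ≤⟨ ∑-mono-≤ capacity ⟩
      ∑[ b < k ] (ι d * z b)
        ≈⟨ *-distribˡ-sum (ι d) z ⟨
      ι d * (∑[ b < k ] z b) ∎

    value≤objective : value ≤ objective q
    value≤objective = begin
      value
        ≈⟨ value-split ⟩
      ι r * (W+S / ι d) + F
        ≤⟨ +-mono-≤ (*-monoˡ-≤ (0≤ι r) (x/z≤y (0<ι d≥1) W+S≤d*∑z)) (∑ι≤∑ι*∑y f) ⟩
      ι r * (∑[ b < k ] z b) + ∑[ c < m ] (ι (f c) * ∑[ b < k ] y c b)
        ≈⟨ objective-split q ⟨
      objective q ∎

  -- Feasibility of the uniform point.

  uniform-feasible : W+Sℕ ℕ.≤ k ℕ.* d → IsFeasible uniform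
  uniform-feasible W+Sℕ≤kd = record
    { assign   = λ i → ∑-1/k
    -- Every capacity constraint is tight: both sides equal `W+S / ι k`.
    ; capacity = λ b → ≤-reflexive load
    ; setup    = λ c i i∈𝓘c b → ≤-refl
    ; 0≤x      = λ i b → 0≤1/k
    ; x≤1      = λ i b → 1/k≤1
    ; 0≤y      = λ c b → 0≤1/k
    ; y≤1      = λ c b → 1/k≤1
    ; 0≤z      = λ b → *-nonNeg (≤-trans (0≤ι W+Sℕ) (≤-reflexive ιW+Sℕ≈W+S)) (0≤⁻¹ 0<ιkιd)
    ; z≤1      = λ b → x≤y⇒x/y≤1 0<ιkιd W+S≤ιkιd
    }
    where
    0≤1/k : 0# ≤ 1# / ι k
    0≤1/k = *-nonNeg 0≤1 (0≤⁻¹ (0<ι 1≤k))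

    1/k≤1 : 1# / ι k ≤ 1#
    1/k≤1 = x≤y⇒x/y≤1 (0<ι 1≤k) (1≤ι 1≤k)

    W+S≤ιkιd : W+S ≤ ι k * ι d
    W+S≤ιkιd = begin
      W+S           ≈⟨ ιW+Sℕ≈W+S ⟨
      ι W+Sℕ        ≤⟨ ι-mono W+Sℕ≤kd ⟩
      ι (k ℕ.* d)   ≈⟨ ι-homo-* k d ⟩
      ι k * ι d     ∎

    load : ∑[ i < n ] (ι (w i) * (1# / ι k)) + ∑[ c < m ] (ι (s c) * (1# / ι k))
             ≈ ι d * (W+S / (ι k * ι d))
    load = begin-equality
      ∑[ i < n ] (ι (w i) * (1# / ι k)) + ∑[ c < m ] (ι (s c) * (1# / ι k))
        ≈⟨ +-cong (*-distribʳ-sum _ (ι ∘ w)) (*-distribʳ-sum _ (ι ∘ s)) ⟨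
      (∑[ i < n ] ι (w i)) * (1# / ι k) + (∑[ c < m ] ι (s c)) * (1# / ι k)
        ≈⟨ distribʳ _ _ _ ⟨
      W+S * (1# / ι k)
        ≈⟨ *-congˡ (*-identityˡ _) ⟩
      W+S / ι k
        ≈⟨ u*[x/z]≈x/v ιk≉0 (0<⇒≉0 0<ιkιd) (*-comm _ _) ⟨
      ι d * (W+S / (ι k * ι d)) ∎

proposition1 :
  ∀ {a ℓ₁ ℓ₂} (K : OrderedField a ℓ₁ ℓ₂) (I : Instance) (k : ℕ) →
  1 ℕ.≤ k → Packing.IsBinBound I k →
  let open OrderedField K
      open Instance I
      open LPN K I k
      W+S = ∑[ i < n ] ι (w i) + ∑[ c < m ] ι (s c)
  in
    IsOptimal ⟨ (λ i b → 1# / ι k) , (λ c b → 1# / ι k) , (λ b → W+S / (ι k * ι d)) ⟩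
    × IsOptimalValue ((ι r / ι d) * W+S + ∑[ c < m ] ι (f c))
proposition1 K I k 1≤k bound = optimal , uniform , optimal , objective-uniform
  where
  open LPNProperties K I 1≤k
  open OrderedFieldProperties K using (≤-trans; ≤-reflexive)
  optimal : LPN.IsOptimal K I k uniform
  optimal = uniform-feasible (PackingProperties.total≤k*d I bound) ,
    λ q feasible → ≤-trans (≤-reflexive objective-uniform) (value≤objective feasible)
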